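{- Every non-decreasing pure $O$-sequence $\underline{h}=(h_0,\dots,h_e)$ of socle degree $e\le 3$ is differentiable.
   Context: For positive integers $n,d$, write $n=\binom{k_d}{d}+\cdots+\binom{k_\delta}{\delta}$ with $k_d>\dots>k_\delta\ge\delta\ge1$ (unique $d$-binomial expansion) and set $(n_{(d)})^1_1=\binom{k_d+1}{d+1}+\cdots+\binom{k_\delta+1}{\delta+1}$; set $(0_{(d)})^1_1=0$. A sequence $(h_0,\dots,h_e)$ of non-negative integers with $h_0=1$ is an $O$-sequence if $h_{d+1}\le((h_d)_{(d)})^1_1$ for all $1\le d<e$. A monomial order ideal is a finite nonempty set of monomials closed under taking divisors; it is pure if all its maximal monomials under divisibility have the same degree $e$, called the socle degree. A pure $O$-sequence is the vector $(h_0,\dots,h_e)$ counting the monomials of each degree in a pure monomial order ideal of socle degree $e$. A sequence is non-decreasing if $h_{i+1}\ge h_i$ for all $i$, and differentiable if $(h_0,h_1-h_0,\dots,h_e-h_{e-1})$ is an $O$-sequence. -}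

module Defs where

open import Data.Nat using (ℕ; zero; suc; _+_; _∸_; _≤_; _≤ᵇ_; _≟_)
open import Data.Nat.Combinatorics using (_C_)
open import Data.Bool using (if_then_else_)
open import Data.Fin using (Fin; toℕ; inject₁) renaming (zero to fzero; suc to fsuc)
open import Data.Vec using (Vec; lookup; tabulate; sum)
open import Data.Vec.Relation.Binary.Pointwise.Inductive using (Pointwise)
open import Data.List using (List; []; filter; length)
open import Data.List.Membership.Propositional using (_∈_)
open import Data.List.Relation.Unary.Unique.Propositional using (Unique)
open import Data.Product using (Σ; _×_)
open import Relation.Binary.PropositionalEquality using (_≡_; _≢_)

top : ℕ → ℕ → ℕ → ℕ
top n d zero    = zero
top n d (suc k) = if (suc k C d) ≤ᵇ n then suc k else top n d k

-- macaulayBound d n = (n_(d))^1_1, computed via the greedy algorithm that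
-- produces the unique d-binomial expansion
--   n = C(k_d,d) + C(k_{d-1},d-1) + ... + C(k_δ,δ),
-- and returns C(k_d+1,d+1) + ... + C(k_δ+1,δ+1).  For n = 0 it returns 0.
-- (For d ≥ 1, the largest k with C(k,d) ≤ n is ≤ n + d.)
macaulayBound : ℕ → ℕ → ℕ
macaulayBound zero    n       = zero
macaulayBound (suc d) zero    = zero
macaulayBound (suc d) (suc m) =
  (suc k C suc (suc d)) + macaulayBound d (suc m ∸ (k C suc d))
  where
  k : ℕ
  k = top (suc m) (suc d) (suc m + suc d)

IsOSequence : ∀ {e} → Vec ℕ (suc e) → Set
IsOSequence {e} h =
  (lookup h fzero ≡ 1) ×
  (∀ (d : Fin e) → 1 ≤ toℕ d →
     lookup h (fsuc d) ≤ macaulayBound (toℕ d) (lookup h (inject₁ d)))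

-- Monomials in r variables = exponent vectors; divisibility = pointwise ≤

Monomial : ℕ → Set
Monomial r = Vec ℕ r

_∣ₘ_ : ∀ {r} → Monomial r → Monomial r → Set
m ∣ₘ m' = Pointwise _≤_ m m'

deg : ∀ {r} → Monomial r → ℕ
deg = sum

IsMonomialOrderIdeal : ∀ {r} → List (Monomial r) → Set
IsMonomialOrderIdeal X =
  Unique X × (X ≢ []) ×
  (∀ {m m'} → m ∈ X → m' ∣ₘ m → m' ∈ X)

IsMaximalIn : ∀ {r} → Monomial r → List (Monomial r) → Set
IsMaximalIn m X = m ∈ X × (∀ {m'} → m' ∈ X → m ∣ₘ m' → m' ≡ m)

IsPure : ∀ {r} → ℕ → List (Monomial r) → Set
IsPure e X = ∀ {m} → IsMaximalIn m X → deg m ≡ e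

countDeg : ∀ {r} → ℕ → List (Monomial r) → ℕ
countDeg i X = length (filter (λ m → deg m ≟ i) X)

IsPureOSequence : ∀ {e} → Vec ℕ (suc e) → Set
IsPureOSequence {e} h =
  Σ ℕ λ r → Σ (List (Monomial r)) λ X →
    IsMonomialOrderIdeal X × IsPure e X ×
    (∀ (i : Fin (suc e)) → lookup h i ≡ countDeg (toℕ i) X)

NonDecreasing : ∀ {e} → Vec ℕ (suc e) → Set
NonDecreasing {e} h = ∀ (i : Fin e) → lookup h (inject₁ i) ≤ lookup h (fsuc i)

Δ : ∀ {e} → Vec ℕ (suc e) → Vec ℕ (suc e)
Δ {e} h = tabulate f
  where
  f : Fin (suc e) → ℕ
  f fzero    = lookup h fzero
  f (fsuc i) = lookup h (fsuc i) ∸ lookup h (inject₁ i)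

-- differentiable: the difference sequence consists of non-negative integers
-- (i.e. no truncation happens in ∸) and is an O-sequence
Differentiable : ∀ {e} → Vec ℕ (suc e) → Set
Differentiable h = NonDecreasing h × IsOSequence (Δ h)

{-# OPTIONS --safe #-}
module Submission where

-- For socle degree 3, regard the degree-2 monomials as the edges and loops of a graph on
-- the variables; the degree-3 monomials are among its (degenerate) 3-cliques.  Write a, r, c
-- for the numbers of edges, vertices and cliques, and f for the Macaulay bound in degree 2.
-- Purity lets the graph be built up by adding either a vertex with a loop or with an earlier
-- neighbour, or a new disjoint loopless triangle.  Along the way e(N) - |N| ≤ a - r,
-- where e(N) counts the edges inside N, holds for every set N of vertices, so adding a vertex whose neighbourhood is N is
-- governed by the inequality f(n) + E ≤ f(n + k) for E ≤ min(k(k+1)/2, n + k), and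
-- c ≤ a + f(a - r) follows by induction.

open import Defs
open import Data.Bool using (true; false; T)
open import Data.Fin using (Fin; toℕ; inject₁) renaming (zero to fzero; suc to fsuc; _≟_ to _≟F_)
import Data.Fin.Properties as Fin
open import Data.List using (List; []; _∷_; _++_; map; filter; length; allFin)
open import Data.List.Membership.Propositional using (_∈_; _∉_; find; lose)
open import Data.List.Membership.Propositional.Properties
import Data.List.Membership.DecPropositional as DecMembership
open import Data.List.Properties using (length-map; length-++; length-tabulate; length-filter; filter-accept; filter-reject; filter-none; filter-some)
open import Data.List.Relation.Binary.Sublist.Propositional using (_⊆_; []; _∷_; _∷ʳ_; minimum)
open import Data.List.Relation.Binary.Sublist.Propositional.Properties using (length-mono-≤; filter-⊆; filter⁺)
open import Data.List.Relation.Unary.All using (All; []; _∷_; head; tail)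
open import Data.List.Relation.Unary.All.Properties using (¬Any⇒All¬)
open import Data.List.Relation.Unary.AllPairs using ([]; _∷_)
open import Data.List.Relation.Unary.Any using (Any; here; there; any?)
open import Data.List.Relation.Unary.Unique.Propositional using (Unique)
import Data.List.Relation.Unary.Unique.Propositional.Properties as Unique
open import Data.Nat using (ℕ; zero; suc; _+_; _*_; _∸_; _≤_; _<_; _≤ᵇ_; _≤′_; ≤′-refl; ≤′-step; _≤?_; _≟_; z≤n; s≤s)
open import Data.Nat.Combinatorics using (_C_; nC1≡n; nCk+nC[k+1]≡[n+1]C[k+1])
open import Data.Nat.Properties hiding (_≟_; _≤?_)
open import Data.Nat.Tactic.RingSolver using (solve-∀)
open import Data.Product using (_×_; _,_; ∃; ∃₂; proj₁; proj₂)
open import Data.Sum using (_⊎_; inj₁; inj₂)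
open import Data.Unit using (tt)
open import Data.Vec using (Vec; []; _∷_; lookup; replicate)
open import Data.Vec.Properties using (≡-dec; ∷-injectiveˡ; ∷-injectiveʳ; lookup-replicate)
open import Data.Vec.Relation.Binary.Pointwise.Inductive as Pointwise using ([]; _∷_)
open import Function using (_∘_; id)
open import Relation.Binary.Definitions using (Decidable)
open import Relation.Binary.PropositionalEquality
open import Relation.Nullary using (¬_; Dec; yes; no; contradiction; ¬?; decidable-stable)
open import Relation.Nullary.Decidable using (_×-dec_)

-- The Macaulay bound in degrees 1 and 2

triangular tetrahedral : ℕ → ℕ
triangular zero = zero
triangular (suc k) = suc k + triangular k
tetrahedral zero = zero
tetrahedral (suc k) = triangular (suc k) + tetrahedral k

triangular≡C : ∀ n → suc n C 2 ≡ triangular n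
triangular≡C zero = refl
triangular≡C (suc n) = begin
  suc (suc n) C 2         ≡⟨ nCk+nC[k+1]≡[n+1]C[k+1] (suc n) 1 ⟨
  suc n C 1 + suc n C 2   ≡⟨ cong₂ _+_ (nC1≡n (suc n)) (triangular≡C n) ⟩
  suc n + triangular n    ∎
  where open ≡-Reasoning

tetrahedral≡C : ∀ n → suc (suc n) C 3 ≡ tetrahedral n
tetrahedral≡C zero = refl
tetrahedral≡C (suc n) = begin
  suc (suc (suc n)) C 3               ≡⟨ nCk+nC[k+1]≡[n+1]C[k+1] (suc (suc n)) 2 ⟨
  suc (suc n) C 2 + suc (suc n) C 3   ≡⟨ cong₂ _+_ (triangular≡C (suc n)) (tetrahedral≡C n) ⟩
  triangular (suc n) + tetrahedral n  ∎
  where open ≡-Reasoning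

triangular-mono-≤ : ∀ {m n} → m ≤ n → triangular m ≤ triangular n
triangular-mono-≤ z≤n = z≤n
triangular-mono-≤ (s≤s m≤n) = +-mono-≤ (s≤s m≤n) (triangular-mono-≤ m≤n)

n≤triangular : ∀ n → n ≤ triangular n
n≤triangular zero = z≤n
n≤triangular (suc n) = m≤m+n (suc n) (triangular n)

triangular-+ : ∀ m n → triangular (m + n) ≡ triangular m + triangular n + m * n
triangular-+ zero n = sym (+-identityʳ _)
triangular-+ (suc m) n = trans (cong (suc (m + n) +_) (triangular-+ m n))
  (lem m n (triangular m) (triangular n))
  where
  lem : ∀ m n a b → suc (m + n) + (a + b + m * n) ≡ suc m + a + b + (n + m * n)
  lem = solve-∀

triangular-pred : ∀ n → triangular n ∸ n ≡ triangular (n ∸ 1)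
triangular-pred zero = refl
triangular-pred (suc n) = m+n∸m≡n (suc n) (triangular n)

-- For positive `n` this is the 2-binomial expansion, with top entries `suc s` and `t`, the second
-- term being absent when `t` is 0. Counting upwards, `t` runs through `0, …, s` before the next row
-- starts.
triangular-split : ∀ n → ∃₂ λ s t → t ≤ s × n ≡ triangular s + t
triangular-split zero = 0 , 0 , z≤n , refl
triangular-split (suc n) with triangular-split n
... | s , t , t≤s , refl with m≤n⇒m<n∨m≡n t≤s
...   | inj₁ t<s  = s , suc t , t<s , sym (+-suc _ t)
...   | inj₂ refl = suc s , 0 , z≤n , cong suc (trans (+-comm _ s) (sym (+-identityʳ _)))

-- The downward search rejects every value above `s` and stops there, so any starting point `K` that
-- is at least `s` gives the same result.
top-greatest : ∀ {n d s} K → s ≤ K → s C d ≤ n → (∀ j → s < j → n < j C d) → top n d K ≡ s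
top-greatest zero z≤n _ _ = refl
top-greatest {n} {d} {s} (suc K) s≤K sCd≤n gt with m≤n⇒m<n∨m≡n s≤K | (suc K C d) ≤ᵇ n in eq
... | inj₁ s<1+K | true  =
  contradiction (≤ᵇ⇒≤ (suc K C d) n (subst T (sym eq) tt)) (<⇒≱ (gt (suc K) s<1+K))
... | inj₁ s<1+K | false = top-greatest K (≤-pred s<1+K) sCd≤n gt
... | inj₂ refl  | true  = refl
... | inj₂ refl  | false = contradiction (subst T eq (≤⇒≤ᵇ sCd≤n)) λ ()

macaulayBound-1 : ∀ n → macaulayBound 1 n ≡ triangular n
macaulayBound-1 zero = refl
macaulayBound-1 (suc m) = begin
  suc (top (suc m) 1 (suc m + 1)) C 2 + 0
    ≡⟨ cong (λ k → suc k C 2 + 0) (top-greatest {suc m} {1} {suc m} (suc m + 1) (m≤m+n (suc m) 1)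
         (≤-reflexive (nC1≡n (suc m))) (λ j m<j → subst (suc m <_) (sym (nC1≡n j)) m<j)) ⟩
  suc (suc m) C 2 + 0   ≡⟨ +-identityʳ _ ⟩
  suc (suc m) C 2       ≡⟨ triangular≡C (suc m) ⟩
  triangular (suc m)    ∎
  where open ≡-Reasoning

-- The condition `t ≤ s` keeps `triangular s + t` below `triangular (suc s)`, so the greedy choice
-- is `suc s` and the remainder `t` is treated in degree 1.
macaulayBound-2′ : ∀ {s t} → t ≤ s → macaulayBound 2 (triangular s + t) ≡ tetrahedral s + triangular t
macaulayBound-2′ {s} {t} t≤s with triangular s + t in eq
-- The value 0 has its own clause in `macaulayBound`; it forces both `s` and `t` to be 0.
... | zero with s
...   | zero = sym (cong triangular (n≤0⇒n≡0 t≤s))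
macaulayBound-2′ {s} {t} t≤s | suc m = begin-equality
  suc k C 3 + macaulayBound 1 (suc m ∸ k C 2)
    ≡⟨ cong (λ k → suc k C 3 + macaulayBound 1 (suc m ∸ k C 2)) k≡1+s ⟩
  suc (suc s) C 3 + macaulayBound 1 (suc m ∸ suc s C 2)
    ≡⟨ cong₂ (λ a b → a + macaulayBound 1 b) (tetrahedral≡C s) rest ⟩
  tetrahedral s + macaulayBound 1 t
    ≡⟨ cong (tetrahedral s +_) (macaulayBound-1 t) ⟩
  tetrahedral s + triangular t ∎
  where
  open ≤-Reasoning
  k = top (suc m) 2 (suc m + 2)
  bound : suc s ≤ suc m + 2
  bound = begin
    suc s ≤⟨ s≤s (≤-trans (n≤triangular s) (m≤m+n _ t)) ⟩
    suc (triangular s + t) ≡⟨ cong suc eq ⟩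
    suc (suc m) ≤⟨ m≤m+n _ 1 ⟩
    suc (suc m) + 1 ≡⟨ cong suc (+-suc m 1) ⟨
    suc m + 2 ∎
  above : ∀ j → suc s < j → suc m < j C 2
  above (suc (suc j)) (s≤s (s≤s s≤j)) = begin-strict
    suc m ≡⟨ eq ⟨
    triangular s + t ≤⟨ +-monoʳ-≤ (triangular s) t≤s ⟩
    triangular s + s ≡⟨ +-comm _ s ⟩
    s + triangular s <⟨ n<1+n _ ⟩
    triangular (suc s) ≤⟨ triangular-mono-≤ (s≤s s≤j) ⟩
    triangular (suc j) ≡⟨ triangular≡C (suc j) ⟨
    suc (suc j) C 2 ∎
  k≡1+s : k ≡ suc s
  k≡1+s = top-greatest (suc m + 2) bound
    (subst₂ _≤_ (sym (triangular≡C s)) eq (m≤m+n _ t)) above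
  rest : suc m ∸ suc s C 2 ≡ t
  rest = trans (cong₂ _∸_ (sym eq) (triangular≡C s)) (m+n∸m≡n (triangular s) t)

-- At `t = suc s` the formula for row `s` agrees with the one for the start of row `suc s`. This
-- overlap lets a unit step across a row boundary be computed like one inside a row.
macaulayBound-2 : ∀ {s t} → t ≤ suc s → macaulayBound 2 (triangular s + t) ≡ tetrahedral s + triangular t
macaulayBound-2 {s} t≤1+s with m≤n⇒m<n∨m≡n t≤1+s
... | inj₁ t<1+s = macaulayBound-2′ (≤-pred t<1+s)
... | inj₂ refl  = begin
  macaulayBound 2 (triangular s + suc s)      ≡⟨ cong (macaulayBound 2) (trans (+-comm _ (suc s)) (sym (+-identityʳ _))) ⟩
  macaulayBound 2 (triangular (suc s) + 0)    ≡⟨ macaulayBound-2′ {suc s} z≤n ⟩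
  triangular (suc s) + tetrahedral s + 0      ≡⟨ trans (+-identityʳ _) (+-comm _ (tetrahedral s)) ⟩
  tetrahedral s + triangular (suc s)          ∎
  where open ≡-Reasoning

macaulayBound-2-suc : ∀ n → macaulayBound 2 n < macaulayBound 2 (suc n)
macaulayBound-2-suc n with triangular-split n
... | s , t , t≤s , refl = begin-strict
  macaulayBound 2 (triangular s + t)      ≡⟨ macaulayBound-2 (m≤n⇒m≤1+n t≤s) ⟩
  tetrahedral s + triangular t            <⟨ +-monoʳ-< (tetrahedral s) (s≤s (m≤n+m (triangular t) t)) ⟩
  tetrahedral s + triangular (suc t)      ≡⟨ macaulayBound-2 (s≤s t≤s) ⟨
  macaulayBound 2 (triangular s + suc t)  ≡⟨ cong (macaulayBound 2) (+-suc (triangular s) t) ⟩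
  macaulayBound 2 (suc (triangular s + t)) ∎
  where open ≤-Reasoning

macaulayBound-2-mono-≤ : ∀ {m n} → m ≤ n → macaulayBound 2 m ≤ macaulayBound 2 n
macaulayBound-2-mono-≤ m≤n = go (≤⇒≤′ m≤n)
  where
  go : ∀ {m n} → m ≤′ n → macaulayBound 2 m ≤ macaulayBound 2 n
  go ≤′-refl = ≤-refl
  go (≤′-step {n} m≤n) = ≤-trans (go m≤n) (<⇒≤ (macaulayBound-2-suc n))

-- Arrange ℕ in rows, row s holding triangular s, …, triangular s + s, on which the bound
-- increases by 1, …, s + 1: a step of length k ≤ s + 1 stays in row s or ends in row s + 1.
short-step : ∀ {s t} k → t ≤ s → k ≤ suc s →
  macaulayBound 2 (triangular s + t) + triangular k ≤ macaulayBound 2 (triangular s + t + k)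
short-step {s} {t} k t≤s k≤1+s with ≤-total (t + k) (suc s)
-- The step stays within the range of the formula for row `s`, and superadditivity of `triangular`
-- gives the bound.
... | inj₁ t+k≤1+s = begin
  macaulayBound 2 (triangular s + t) + triangular k ≡⟨ cong (_+ triangular k) (macaulayBound-2 (m≤n⇒m≤1+n t≤s)) ⟩
  tetrahedral s + triangular t + triangular k       ≡⟨ +-assoc (tetrahedral s) _ _ ⟩
  tetrahedral s + (triangular t + triangular k)     ≤⟨ +-monoʳ-≤ (tetrahedral s) (m≤m+n _ (t * k)) ⟩
  tetrahedral s + (triangular t + triangular k + t * k) ≡⟨ cong (tetrahedral s +_) (triangular-+ t k) ⟨
  tetrahedral s + triangular (t + k)                ≡⟨ macaulayBound-2 t+k≤1+s ⟨
  macaulayBound 2 (triangular s + (t + k))          ≡⟨ cong (macaulayBound 2) (+-assoc (triangular s) t k) ⟨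
  macaulayBound 2 (triangular s + t + k)            ∎
  where open ≤-Reasoning
-- The step splits into `u` moves that finish row `s` and `v` moves in row `suc s`. The cross term
-- `v * u` of `triangular (v + u)` is at most `t * u`, which is what completes
-- `triangular t + triangular u` to `triangular (suc s)`.
... | inj₂ 1+s≤t+k = begin
  macaulayBound 2 (triangular s + t) + triangular k
    ≡⟨ cong₂ (λ a b → a + triangular b) (macaulayBound-2 (m≤n⇒m≤1+n t≤s)) k≡v+u ⟩
  tetrahedral s + triangular t + triangular (v + u)
    ≡⟨ cong (tetrahedral s + triangular t +_) (triangular-+ v u) ⟩
  tetrahedral s + triangular t + (triangular v + triangular u + v * u)
    ≤⟨ +-monoʳ-≤ (tetrahedral s + triangular t) (+-monoʳ-≤ (triangular v + triangular u) (*-monoˡ-≤ u v≤t)) ⟩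
  tetrahedral s + triangular t + (triangular v + triangular u + t * u)
    ≡⟨ lem (tetrahedral s) (triangular t) (triangular v) (triangular u) (t * u) ⟩
  triangular t + triangular u + t * u + tetrahedral s + triangular v
    ≡⟨ cong (λ x → x + tetrahedral s + triangular v) (triangular-+ t u) ⟨
  triangular (t + u) + tetrahedral s + triangular v
    ≡⟨ cong (λ x → triangular x + tetrahedral s + triangular v) t+u≡1+s ⟩
  tetrahedral (suc s) + triangular v
    ≡⟨ macaulayBound-2 {suc s} (≤-trans v≤t (m≤n⇒m≤1+n (m≤n⇒m≤1+n t≤s))) ⟨
  macaulayBound 2 (triangular (suc s) + v)
    ≡⟨ cong (macaulayBound 2) shift ⟩
  macaulayBound 2 (triangular s + t + k) ∎
  where
  open ≤-Reasoning
  u v : ℕ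
  u = suc s ∸ t
  v = t + k ∸ suc s
  t+u≡1+s : t + u ≡ suc s
  t+u≡1+s = m+[n∸m]≡n (m≤n⇒m≤1+n t≤s)
  k≡v+u : k ≡ v + u
  k≡v+u = +-cancelˡ-≡ t k (v + u) (begin-equality
    t + k       ≡⟨ m+[n∸m]≡n 1+s≤t+k ⟨
    suc s + v   ≡⟨ cong (_+ v) t+u≡1+s ⟨
    t + u + v   ≡⟨ +-assoc t u v ⟩
    t + (u + v) ≡⟨ cong (t +_) (+-comm u v) ⟩
    t + (v + u) ∎)
  v≤t : v ≤ t
  v≤t = ≤-trans (∸-monoˡ-≤ (suc s) (+-monoʳ-≤ t k≤1+s)) (≤-reflexive (m+n∸n≡m t (suc s)))
  shift : triangular (suc s) + v ≡ triangular s + t + k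
  shift = begin-equality
    suc s + triangular s + v   ≡⟨ cong (_+ v) (+-comm (suc s) (triangular s)) ⟩
    triangular s + suc s + v   ≡⟨ +-assoc (triangular s) (suc s) v ⟩
    triangular s + (suc s + v) ≡⟨ cong (triangular s +_) (m+[n∸m]≡n 1+s≤t+k) ⟩
    triangular s + (t + k)     ≡⟨ +-assoc (triangular s) t k ⟨
    triangular s + t + k       ∎
  lem : ∀ a b c d e → a + b + (c + d + e) ≡ b + d + e + a + c
  lem = solve-∀

-- For `j = 0` the step ends at position `suc t` of row `suc s`, with equality. Each further unit
-- raises `n + k` by one and the bound by at least one.
long-step : ∀ {s t} j → t ≤ s → let n = triangular s + t; k = j + suc (suc s) in
  macaulayBound 2 n + (n + k) ≤ macaulayBound 2 (n + k)
long-step {s} {t} zero t≤s = begin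
  macaulayBound 2 (triangular s + t) + (triangular s + t + suc (suc s))
    ≡⟨ cong (_+ (triangular s + t + suc (suc s))) (macaulayBound-2 (m≤n⇒m≤1+n t≤s)) ⟩
  tetrahedral s + triangular t + (triangular s + t + suc (suc s))
    ≡⟨ lem s t (tetrahedral s) (triangular s) (triangular t) ⟩
  tetrahedral (suc s) + triangular (suc t)
    ≡⟨ macaulayBound-2 {suc s} (m≤n⇒m≤1+n (s≤s t≤s)) ⟨
  macaulayBound 2 (triangular (suc s) + suc t)
    ≡⟨ cong (macaulayBound 2) (lem′ s t (triangular s)) ⟩
  macaulayBound 2 (triangular s + t + suc (suc s)) ∎
  where
  open ≤-Reasoning
  lem : ∀ s t a b c → a + c + (b + t + (2 + s)) ≡ suc s + b + a + (suc t + c)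
  lem = solve-∀
  lem′ : ∀ s t a → suc s + a + suc t ≡ a + t + (2 + s)
  lem′ = solve-∀
long-step {s} {t} (suc j) t≤s = begin
  macaulayBound 2 n + (n + suc k)    ≡⟨ cong (macaulayBound 2 n +_) (+-suc n k) ⟩
  macaulayBound 2 n + suc (n + k)    ≡⟨ +-suc _ (n + k) ⟩
  suc (macaulayBound 2 n + (n + k))  ≤⟨ s≤s (long-step j t≤s) ⟩
  suc (macaulayBound 2 (n + k))      ≤⟨ macaulayBound-2-suc (n + k) ⟩
  macaulayBound 2 (suc (n + k))      ≡⟨ cong (macaulayBound 2) (+-suc n k) ⟨
  macaulayBound 2 (n + suc k)        ∎
  where
  open ≤-Reasoning
  n = triangular s + t
  k = j + suc (suc s)

-- The row `s` of `n` decides which hypothesis on `E` is used: the triangular one while `k ≤ suc s`,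
-- the linear one beyond.
macaulayBound-2-step : ∀ n k {E} → E ≤ triangular k → E ≤ n + k →
  macaulayBound 2 n + E ≤ macaulayBound 2 (n + k)
macaulayBound-2-step n k E≤Tk E≤n+k with triangular-split n
... | s , t , t≤s , refl with k ≤? suc s
...   | yes k≤1+s = ≤-trans (+-monoʳ-≤ (macaulayBound 2 n) E≤Tk) (short-step k t≤s k≤1+s)
...   | no  k≰1+s = ≤-trans (+-monoʳ-≤ (macaulayBound 2 n) E≤n+k)
  (subst (λ k → macaulayBound 2 n + (n + k) ≤ macaulayBound 2 (n + k))
    (m∸n+n≡m (≰⇒> k≰1+s)) (long-step (k ∸ suc (suc s)) t≤s))

-- Counting edges and cliques along a vertex list

∸-cancelʳ-+ : ∀ m n o → m + n ∸ (o + n) ≡ m ∸ o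
∸-cancelʳ-+ m n o = trans (cong₂ _∸_ (+-comm m n) (+-comm o n)) ([m+n]∸[m+o]≡n∸o n m o)

-- Arithmetic for `excess` with one, two or three triangle vertices kept: their degrees stand on the
-- left, and on the right their number, written as a sum of bounds on those degrees.
swap-bound₁ : ∀ {d e l b} → d ≤ b → d + e + l ≤ e + (b + l)
swap-bound₁ {d} {e} {l} {b} d≤b = begin
  d + e + l   ≤⟨ +-monoˡ-≤ l (+-monoˡ-≤ e d≤b) ⟩
  b + e + l   ≡⟨ cong (_+ l) (+-comm b e) ⟩
  e + b + l   ≡⟨ +-assoc e b l ⟩
  e + (b + l) ∎
  where open ≤-Reasoning

swap-bound₂ : ∀ {c d e l p q} → c ≤ p → d ≤ q → c + (d + e) + l ≤ e + (p + q + l)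
swap-bound₂ {c} {d} {e} c≤p d≤q rewrite sym (+-assoc c d e) = swap-bound₁ (+-mono-≤ c≤p d≤q)

swap-bound₃ : ∀ {a c d e l o p q} → a ≤ o → c ≤ p → d ≤ q → a + (c + (d + e)) + l ≤ e + (o + (p + q) + l)
swap-bound₃ {c = c} {d} {e} a≤o c≤p d≤q rewrite sym (+-assoc c d e) = swap-bound₂ a≤o (+-mono-≤ c≤p d≤q)

module Graph {V : Set} {_~_ : V → V → Set} (_~?_ : Decidable _~_) where

  nbrs : V → List V → List V
  nbrs x = filter (x ~?_)

  -- Each edge is counted at its first endpoint in the list, each clique at its first vertex. As `x`
  -- is among its own candidate neighbours, loops and degenerate cliques are included.
  edges cliques : List V → ℕ
  edges [] = 0
  edges (x ∷ S) = length (nbrs x (x ∷ S)) + edges S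
  cliques [] = 0
  cliques (x ∷ S) = edges (nbrs x (x ∷ S)) + cliques S

  edges≤triangular : ∀ S → edges S ≤ triangular (length S)
  edges≤triangular [] = z≤n
  edges≤triangular (x ∷ S) = +-mono-≤ (length-filter (x ~?_) (x ∷ S)) (edges≤triangular S)

  nbrs-mono : ∀ x {N S} → N ⊆ S → length (nbrs x N) ≤ length (nbrs x S)
  nbrs-mono x N⊆S = length-mono-≤ (filter⁺ (x ~?_) (x ~?_) (λ { refl p → p }) N⊆S)

  -- The difference of edges and vertices is largest for `S` itself; the additive form avoids
  -- truncated subtraction.
  Sparse : List V → Set
  Sparse S = ∀ {N} → N ⊆ S → edges N + length S ≤ edges S + length N

  -- Lists grow at the front. Each `All` ranges over the vertex itself and `S`, so it excludes a
  -- loop along with edges to `S`. A loopless component cannot be started by `vertex`, hence the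
  -- third constructor.
  data Grown : List V → Set where
    []       : Grown []
    vertex   : ∀ {x S} → Any (x ~_) (x ∷ S) → Grown S → Grown (x ∷ S)
    triangle : ∀ {x y z S} → x ~ y → x ~ z → y ~ z →
      All (λ w → ¬ x ~ w) (x ∷ S) → All (λ w → ¬ y ~ w) (y ∷ S) → All (λ w → ¬ z ~ w) (z ∷ S) →
      Grown S → Grown (x ∷ y ∷ z ∷ S)

  module Triangle {x y z S} (x~y : x ~ y) (x~z : x ~ z) (y~z : y ~ z)
    (x≁ : All (λ w → ¬ x ~ w) (x ∷ S)) (y≁ : All (λ w → ¬ y ~ w) (y ∷ S))
    (z≁ : All (λ w → ¬ z ~ w) (z ∷ S)) where

    nbrs-z : nbrs z (z ∷ S) ≡ []
    nbrs-z = filter-none (z ~?_) z≁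

    nbrs-y : nbrs y (y ∷ z ∷ S) ≡ z ∷ []
    nbrs-y = trans (filter-reject (y ~?_) (head y≁))
      (trans (filter-accept (y ~?_) y~z) (cong (z ∷_) (filter-none (y ~?_) (tail y≁))))

    nbrs-x : nbrs x (x ∷ y ∷ z ∷ S) ≡ y ∷ z ∷ []
    nbrs-x = trans (filter-reject (x ~?_) (head x≁)) (trans (filter-accept (x ~?_) x~y)
      (cong (y ∷_) (trans (filter-accept (x ~?_) x~z) (cong (z ∷_) (filter-none (x ~?_) (tail x≁))))))

    edges-triangle : edges (x ∷ y ∷ z ∷ S) ≡ 3 + edges S
    edges-triangle rewrite nbrs-x | nbrs-y | nbrs-z = refl

    -- Only the clique on `x`, `y`, `z` is new; the generous 3 matches the number of new edges.
    cliques-triangle : cliques (x ∷ y ∷ z ∷ S) ≤ 3 + cliques S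
    cliques-triangle
      rewrite nbrs-x | nbrs-y | nbrs-z
            | filter-reject (y ~?_) {xs = z ∷ []} (head y≁) | filter-accept (y ~?_) {xs = []} y~z
            | filter-reject (z ~?_) {xs = []} (head z≁) = m≤n+m _ 2

    nbrs-x≤0 : ∀ {N} → N ⊆ x ∷ S → length (nbrs x N) ≤ 0
    nbrs-x≤0 p = subst (λ l → _ ≤ length l) (filter-none (x ~?_) x≁) (nbrs-mono x p)

    nbrs-z≤0 : ∀ {N} → N ⊆ z ∷ S → length (nbrs z N) ≤ 0
    nbrs-z≤0 p = subst (λ l → _ ≤ length l) nbrs-z (nbrs-mono z p)

    nbrs-y≤0 : ∀ {N} → N ⊆ y ∷ S → length (nbrs y N) ≤ 0
    nbrs-y≤0 p = subst (λ l → _ ≤ length l) (filter-none (y ~?_) y≁) (nbrs-mono y p)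

    nbrs-y≤1 : ∀ {N} → N ⊆ y ∷ z ∷ S → length (nbrs y N) ≤ 1
    nbrs-y≤1 p = subst (λ l → _ ≤ length l) nbrs-y (nbrs-mono y p)

    nbrs-x≤2 : ∀ {N} → N ⊆ x ∷ y ∷ z ∷ S → length (nbrs x N) ≤ 2
    nbrs-x≤2 p = subst (λ l → _ ≤ length l) nbrs-x (nbrs-mono x p)

    -- `N` is the part of `M` inside `S`. One, two or three vertices of the triangle span at most 0,
    -- 1 or 3 edges, never more than their number, and send none to `S`.
    excess : ∀ {M} → M ⊆ x ∷ y ∷ z ∷ S → ∃ λ N → N ⊆ S × edges M + length N ≤ edges N + length M
    excess (_ ∷ʳ _ ∷ʳ _ ∷ʳ τ) = _ , τ , ≤-refl
    excess (_ ∷ʳ _ ∷ʳ refl ∷ τ) = _ , τ , swap-bound₁ (m≤n⇒m≤1+n (nbrs-z≤0 (refl ∷ τ)))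
    excess (_ ∷ʳ refl ∷ _ ∷ʳ τ) = _ , τ , swap-bound₁ (m≤n⇒m≤1+n (nbrs-y≤0 (refl ∷ τ)))
    excess (_ ∷ʳ refl ∷ refl ∷ τ) = _ , τ ,
      swap-bound₂ (nbrs-y≤1 (refl ∷ refl ∷ τ)) (m≤n⇒m≤1+n (nbrs-z≤0 (refl ∷ τ)))
    excess (refl ∷ _ ∷ʳ _ ∷ʳ τ) = _ , τ , swap-bound₁ (m≤n⇒m≤1+n (nbrs-x≤0 (refl ∷ τ)))
    excess (refl ∷ _ ∷ʳ refl ∷ τ) = _ , τ ,
      swap-bound₂ (nbrs-x≤2 (refl ∷ _ ∷ʳ refl ∷ τ)) (nbrs-z≤0 (refl ∷ τ))
    excess (refl ∷ refl ∷ _ ∷ʳ τ) = _ , τ ,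
      swap-bound₂ (nbrs-x≤2 (refl ∷ refl ∷ _ ∷ʳ τ)) (nbrs-y≤0 (refl ∷ τ))
    excess (refl ∷ refl ∷ refl ∷ τ) = _ , τ ,
      swap-bound₃ (nbrs-x≤2 (refl ∷ refl ∷ refl ∷ τ)) (nbrs-y≤1 (refl ∷ refl ∷ τ)) (nbrs-z≤0 (refl ∷ τ))

    sparse : Sparse S → Sparse (x ∷ y ∷ z ∷ S)
    sparse sp {M} M⊆ with excess M⊆
    ... | N , N⊆S , le = +-cancelʳ-≤ (length N) _ _ (begin
      edges M + (3 + length S) + length N      ≡⟨ lem₁ (edges M) (length S) (length N) ⟩
      3 + (edges M + length N) + length S      ≤⟨ +-monoˡ-≤ (length S) (+-monoʳ-≤ 3 le) ⟩
      3 + (edges N + length M) + length S      ≡⟨ lem₂ (edges N) (length M) (length S) ⟩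
      3 + (edges N + length S) + length M      ≤⟨ +-monoˡ-≤ (length M) (+-monoʳ-≤ 3 (sp N⊆S)) ⟩
      3 + (edges S + length N) + length M      ≡⟨ lem₃ (edges S) (length N) (length M) ⟩
      3 + edges S + length M + length N        ≡⟨ cong (λ e → e + length M + length N) edges-triangle ⟨
      edges (x ∷ y ∷ z ∷ S) + length M + length N ∎)
      where
      open ≤-Reasoning
      lem₁ : ∀ a b c → a + (3 + b) + c ≡ 3 + (a + c) + b
      lem₁ = solve-∀
      lem₂ : ∀ a b c → 3 + (a + b) + c ≡ 3 + (a + c) + b
      lem₂ = solve-∀
      lem₃ : ∀ a b c → 3 + (a + b) + c ≡ 3 + a + c + b
      lem₃ = solve-∀

  -- If the sublist omits `x`, the right side gains the degree of `x`, which is at least 1, against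
  -- one new vertex. If it contains `x`, the degree of `x` in the sublist is at most that in the
  -- whole list.
  sparse-vertex : ∀ {x S} → Any (x ~_) (x ∷ S) → Sparse S → Sparse (x ∷ S)
  sparse-vertex {x} {S} x~ sp {N} (_ ∷ʳ N⊆S) = begin
    edges N + suc (length S)       ≡⟨ +-suc (edges N) _ ⟩
    1 + (edges N + length S)       ≤⟨ +-mono-≤ (filter-some (x ~?_) x~) (sp N⊆S) ⟩
    d + (edges S + length N)       ≡⟨ +-assoc d _ _ ⟨
    d + edges S + length N         ∎
    where
    open ≤-Reasoning
    d = length (nbrs x (x ∷ S))
  sparse-vertex {x} {S} x~ sp {_ ∷ N} (refl ∷ N⊆S) = begin
    d′ + edges N + suc (length S)    ≡⟨ lem d′ (edges N) (length S) ⟩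
    suc (d′ + (edges N + length S))  ≤⟨ s≤s (+-mono-≤ (nbrs-mono x (refl ∷ N⊆S)) (sp N⊆S)) ⟩
    suc (d + (edges S + length N))   ≡⟨ lem d (edges S) (length N) ⟨
    d + edges S + suc (length N)     ∎
    where
    open ≤-Reasoning
    d d′ : ℕ
    d = length (nbrs x (x ∷ S))
    d′ = length (nbrs x (x ∷ N))
    lem : ∀ a b c → a + b + suc c ≡ suc (a + (b + c))
    lem = solve-∀

  grown⇒sparse : ∀ {S} → Grown S → Sparse S
  grown⇒sparse [] [] = z≤n
  grown⇒sparse (vertex x~ G) = sparse-vertex x~ (grown⇒sparse G)
  grown⇒sparse (triangle x~y x~z y~z x≁ y≁ z≁ G) =
    Triangle.sparse x~y x~z y~z x≁ y≁ z≁ (grown⇒sparse G)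

  -- The case of the empty sublist; it guarantees that `edges S ∸ length S` is not truncated.
  sparse-length : ∀ {S} → Sparse S → length S ≤ edges S
  sparse-length {S} sp = subst (length S ≤_) (+-identityʳ _) (sp (minimum S))

  -- If x carries a loop, E counts the edges among its other neighbours; otherwise
  -- E is what remains after discarding one edge per neighbour.
  neighbourhood-edges : ∀ {x S} → Any (x ~_) (x ∷ S) → Sparse S →
    ∃₂ λ k E → length (nbrs x (x ∷ S)) ≡ suc k × edges (nbrs x (x ∷ S)) ≤ suc k + E ×
      E ≤ triangular k × E ≤ edges S ∸ length S + k
  neighbourhood-edges {x} {S} x~ sp with x ~? x
  ... | yes x~x =
    length N , edges N , refl ,
    +-monoˡ-≤ (edges N) (length-filter (x ~?_) (x ∷ N)) ,
    edges≤triangular N ,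
    (begin
      edges N                          ≡⟨ m+n∸n≡m (edges N) (length S) ⟨
      edges N + length S ∸ length S    ≤⟨ ∸-monoˡ-≤ (length S) (sp (filter-⊆ (x ~?_) S)) ⟩
      edges S + length N ∸ length S    ≡⟨ +-∸-comm (length N) (sparse-length sp) ⟩
      edges S ∸ length S + length N    ∎)
    where
    open ≤-Reasoning
    N = nbrs x S
  -- The neighbourhood is now `N` itself, and `pos` makes its length some `suc k`. Sparsity bounds
  -- the excess of edges over vertices in `N`, which is what `E` measures.
  ... | no ¬x~x with filter-some (x ~?_) x~
  ...   | pos rewrite filter-reject (x ~?_) {xs = S} ¬x~x with length (nbrs x S) in eq
  ...     | suc k =
    k , edges N ∸ suc k , refl ,
    m≤n+m∸n (edges N) (suc k) ,
    (begin
      edges N ∸ suc k                  ≤⟨ ∸-monoˡ-≤ (suc k) (edges≤triangular N) ⟩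
      triangular (length N) ∸ suc k    ≡⟨ cong (λ l → triangular l ∸ suc k) eq ⟩
      triangular (suc k) ∸ suc k       ≡⟨ m+n∸m≡n (suc k) (triangular k) ⟩
      triangular k                     ∎) ,
    (begin
      edges N ∸ suc k                           ≡⟨ ∸-cancelʳ-+ (edges N) (length S) (suc k) ⟨
      edges N + length S ∸ (suc k + length S)   ≤⟨ ∸-monoˡ-≤ (suc k + length S) (sp (filter-⊆ (x ~?_) S)) ⟩
      edges S + length N ∸ (suc k + length S)   ≡⟨ cong₂ (λ a b → edges S + a ∸ b) eq (+-comm (suc k) (length S)) ⟩
      edges S + suc k ∸ (length S + suc k)      ≡⟨ ∸-cancelʳ-+ (edges S) (suc k) (length S) ⟩
      edges S ∸ length S                        ≤⟨ m≤m+n _ k ⟩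
      edges S ∸ length S + k                    ∎)
    where
    open ≤-Reasoning
    N = nbrs x S

  -- A vertex of degree `suc k` adds `suc k` edges, raises edges minus vertices by `k` and adds at
  -- most `suc k + E` cliques; `macaulayBound-2-step` absorbs `E`. A triangle leaves edges minus
  -- vertices unchanged, and its 3 edges pay for its cliques.
  cliques-bound : ∀ {S} → Grown S → cliques S ≤ edges S + macaulayBound 2 (edges S ∸ length S)
  cliques-bound [] = z≤n
  cliques-bound (vertex {x} {S} x~ G) with neighbourhood-edges x~ (grown⇒sparse G)
  ... | k , E , deg≡ , edges≤ , E≤tri , E≤ = begin
    edges (nbrs x (x ∷ S)) + cliques S             ≤⟨ +-mono-≤ edges≤ (cliques-bound G) ⟩
    suc k + E + (edges S + macaulayBound 2 n)      ≡⟨ lem (suc k) E (edges S) (macaulayBound 2 n) ⟩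
    suc k + edges S + (macaulayBound 2 n + E)      ≤⟨ +-monoʳ-≤ (suc k + edges S) (macaulayBound-2-step n k E≤tri E≤) ⟩
    suc k + edges S + macaulayBound 2 (n + k)      ≡⟨ cong (λ m → suc k + edges S + macaulayBound 2 m) n+k≡ ⟩
    suc k + edges S + macaulayBound 2 (suc k + edges S ∸ suc (length S))
      ≡⟨ cong (λ d → d + edges S + macaulayBound 2 (d + edges S ∸ suc (length S))) deg≡ ⟨
    edges (x ∷ S) + macaulayBound 2 (edges (x ∷ S) ∸ suc (length S)) ∎
    where
    open ≤-Reasoning
    n = edges S ∸ length S
    n+k≡ : n + k ≡ k + edges S ∸ length S
    n+k≡ = trans (sym (+-∸-comm k (sparse-length (grown⇒sparse G)))) (cong (_∸ length S) (+-comm (edges S) k))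
    lem : ∀ a b c d → a + b + (c + d) ≡ a + c + (d + b)
    lem = solve-∀
  cliques-bound (triangle {S = S} x~y x~z y~z x≁ y≁ z≁ G) = begin
    _                                                   ≤⟨ cliques-triangle ⟩
    3 + cliques S                                       ≤⟨ +-monoʳ-≤ 3 (cliques-bound G) ⟩
    3 + (edges S + macaulayBound 2 (edges S ∸ length S)) ≡⟨⟩
    3 + edges S + macaulayBound 2 (3 + edges S ∸ (3 + length S))
      ≡⟨ cong (λ e → e + macaulayBound 2 (e ∸ (3 + length S))) edges-triangle ⟨
    _ ∎
    where
    open ≤-Reasoning
    open Triangle x~y x~z y~z x≁ y≁ z≁

-- Monomials and order ideals

-- Deleting one occurrence of the head from `ys` keeps the tail included, since by uniqueness the
-- head does not recur. All comparisons of layer counts rest on this.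
unique⇒length≤ : ∀ {A : Set} {xs ys : List A} → Unique xs →
  (∀ {v} → v ∈ xs → v ∈ ys) → length xs ≤ length ys
unique⇒length≤ {xs = []} _ _ = z≤n
unique⇒length≤ {xs = x ∷ xs} u@(_ ∷ uxs) xs⊆ys with ∈-∃++ (xs⊆ys (here refl))
... | as , bs , refl = begin
  suc (length xs)                ≤⟨ s≤s (unique⇒length≤ uxs keep) ⟩
  suc (length (as ++ bs))        ≡⟨ cong suc (length-++ as) ⟩
  suc (length as + length bs)    ≡⟨ +-suc (length as) (length bs) ⟨
  length as + length (x ∷ bs)    ≡⟨ length-++ as ⟨
  length (as ++ x ∷ bs)          ∎
  where
  open ≤-Reasoning
  keep : ∀ {v} → v ∈ xs → v ∈ as ++ bs
  keep v∈xs with ∈-++⁻ as (xs⊆ys (there v∈xs))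
  ... | inj₁ v∈as         = ∈-++⁺ˡ v∈as
  ... | inj₂ (here refl)  = contradiction v∈xs (Unique.Unique[x∷xs]⇒x∉xs u)
  ... | inj₂ (there v∈bs) = ∈-++⁺ʳ as v∈bs

nonempty⇒∈ : ∀ {A : Set} {xs : List A} → xs ≢ [] → ∃ (_∈ xs)
nonempty⇒∈ {xs = []} ne = contradiction refl ne
nonempty⇒∈ {xs = x ∷ xs} _ = x , here refl

unique-∷ : ∀ {A : Set} {x : A} {xs} → x ∉ xs → Unique xs → Unique (x ∷ xs)
unique-∷ x∉xs uxs = ¬Any⇒All¬ _ x∉xs ∷ uxs

-- Multiplication by a variable and divisibility

infixr 30 _·_

_·_ : ∀ {r} → Fin r → Monomial r → Monomial r
fzero  · (a ∷ m) = suc a ∷ m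
fsuc i · (a ∷ m) = a ∷ (i · m)

one : ∀ {r} → Monomial r
one = replicate _ 0

edge : ∀ {r} → Fin r → Fin r → Monomial r
edge i j = i · j · one

·-comm : ∀ {r} (i j : Fin r) m → i · j · m ≡ j · i · m
·-comm fzero    fzero    (a ∷ m) = refl
·-comm fzero    (fsuc j) (a ∷ m) = refl
·-comm (fsuc i) fzero    (a ∷ m) = refl
·-comm (fsuc i) (fsuc j) (a ∷ m) = cong (a ∷_) (·-comm i j m)

·-injectiveʳ : ∀ {r} (i : Fin r) {m m′} → i · m ≡ i · m′ → m ≡ m′
·-injectiveʳ fzero    {a ∷ m} {b ∷ m′} eq =
  cong₂ _∷_ (suc-injective (∷-injectiveˡ eq)) (∷-injectiveʳ eq)
·-injectiveʳ (fsuc i) {a ∷ m} {b ∷ m′} eq =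
  cong₂ _∷_ (∷-injectiveˡ eq) (·-injectiveʳ i (∷-injectiveʳ eq))

·-injectiveˡ : ∀ {r} {i j : Fin r} m → i · m ≡ j · m → i ≡ j
·-injectiveˡ {i = fzero}  {fzero}  (a ∷ m) eq = refl
·-injectiveˡ {i = fzero}  {fsuc j} (a ∷ m) eq = contradiction (∷-injectiveˡ eq) 1+n≢n
·-injectiveˡ {i = fsuc i} {fzero}  (a ∷ m) eq = contradiction (sym (∷-injectiveˡ eq)) 1+n≢n
·-injectiveˡ {i = fsuc i} {fsuc j} (a ∷ m) eq = cong fsuc (·-injectiveˡ m (∷-injectiveʳ eq))

deg-· : ∀ {r} (i : Fin r) m → deg (i · m) ≡ suc (deg m)
deg-· fzero    (a ∷ m) = refl
deg-· (fsuc i) (a ∷ m) = trans (cong (a +_) (deg-· i m)) (+-suc a (deg m))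

deg-one : ∀ r → deg (one {r}) ≡ 0
deg-one zero = refl
deg-one (suc r) = deg-one r

deg-vertex : ∀ {r} (i : Fin r) → deg (i · one) ≡ 1
deg-vertex {r} i = trans (deg-· i one) (cong suc (deg-one r))

deg-edge : ∀ {r} (i j : Fin r) → deg (edge i j) ≡ 2
deg-edge i j = trans (deg-· i (j · one)) (cong suc (deg-vertex j))

deg≡0⇒one : ∀ {r} (m : Monomial r) → deg m ≡ 0 → m ≡ one
deg≡0⇒one [] _ = refl
deg≡0⇒one (zero ∷ m) eq = cong (0 ∷_) (deg≡0⇒one m eq)

deg≡suc⇒· : ∀ {r d} (m : Monomial r) → deg m ≡ suc d → ∃₂ λ i m′ → m ≡ i · m′ × deg m′ ≡ d
deg≡suc⇒· (suc a ∷ m) eq = fzero , a ∷ m , refl , suc-injective eq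
deg≡suc⇒· (zero ∷ m) eq with deg≡suc⇒· m eq
... | i , m′ , refl , eq′ = fsuc i , 0 ∷ m′ , refl , eq′

∣-refl : ∀ {r} {m : Monomial r} → m ∣ₘ m
∣-refl = Pointwise.refl ≤-refl

one-∣ : ∀ {r} (m : Monomial r) → one ∣ₘ m
one-∣ [] = []
one-∣ (a ∷ m) = z≤n ∷ one-∣ m

∣-· : ∀ {r} (i : Fin r) {m m′} → m ∣ₘ m′ → m ∣ₘ i · m′
∣-· fzero    (a≤b ∷ p) = m≤n⇒m≤1+n a≤b ∷ p
∣-· (fsuc i) (a≤b ∷ p) = a≤b ∷ ∣-· i p

·-mono-∣ : ∀ {r} (i : Fin r) {m m′} → m ∣ₘ m′ → i · m ∣ₘ i · m′
·-mono-∣ fzero    (a≤b ∷ p) = s≤s a≤b ∷ p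
·-mono-∣ (fsuc i) (a≤b ∷ p) = a≤b ∷ ·-mono-∣ i p

-- The variable is the first one whose exponent strictly increases. This turns a proper multiple
-- into one of degree just one higher.
∣∧≢⇒· : ∀ {r} {m m′ : Monomial r} → m ∣ₘ m′ → m′ ≢ m → ∃ λ i → i · m ∣ₘ m′
∣∧≢⇒· [] ne = contradiction refl ne
∣∧≢⇒· (a≤b ∷ p) ne with m≤n⇒m<n∨m≡n a≤b
... | inj₁ a<b = fzero , a<b ∷ p
... | inj₂ refl with ∣∧≢⇒· p (ne ∘ cong (_ ∷_))
...   | i , q = fsuc i , a≤b ∷ q

lookup-· : ∀ {r} (i : Fin r) m → lookup (i · m) i ≡ suc (lookup m i)
lookup-· fzero    (a ∷ m) = refl
lookup-· (fsuc i) (a ∷ m) = lookup-· i m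

lookup-·-≢ : ∀ {r} {i j : Fin r} m → i ≢ j → lookup (j · m) i ≡ lookup m i
lookup-·-≢ {i = fzero}  {fzero}  (a ∷ m) i≢j = contradiction refl i≢j
lookup-·-≢ {i = fzero}  {fsuc j} (a ∷ m) i≢j = refl
lookup-·-≢ {i = fsuc i} {fzero}  (a ∷ m) i≢j = refl
lookup-·-≢ {i = fsuc i} {fsuc j} (a ∷ m) i≢j = lookup-·-≢ m (i≢j ∘ cong fsuc)

-- Compare exponents of `x`: positive on the left, but 0 on the right if `x` differs from `u` and
-- `v`.
edge-endpoint : ∀ {r} {x y u v : Fin r} → edge x y ≡ edge u v → x ≡ u ⊎ x ≡ v
edge-endpoint {x = x} {y} {u} {v} eq with x ≟F u | x ≟F v
... | yes x≡u | _       = inj₁ x≡u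
... | no _    | yes x≡v = inj₂ x≡v
... | no x≢u  | no x≢v  = contradiction
  (begin
    0                          ≡⟨ lookup-replicate x 0 ⟨
    lookup one x               ≡⟨ lookup-·-≢ one x≢v ⟨
    lookup (v · one) x         ≡⟨ lookup-·-≢ (v · one) x≢u ⟨
    lookup (edge u v) x        ≡⟨ cong (λ m → lookup m x) eq ⟨
    lookup (edge x y) x        ≡⟨ lookup-· x (y · one) ⟩
    suc (lookup (y · one) x)   ∎)
  0≢1+n
  where open ≡-Reasoning

-- The graph of an order ideal

module OrderIdeal {r} (X : List (Monomial r)) (ideal : IsMonomialOrderIdeal X) where

  _≟ₘ_ : (m m′ : Monomial r) → Dec (m ≡ m′)
  _≟ₘ_ = ≡-dec _≟_

  open DecMembership _≟ₘ_ using () renaming (_∈?_ to _∈ₘ?_)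
  open DecMembership (_≟F_ {r}) using (_∈?_)

  unique-X : Unique X
  unique-X = proj₁ ideal

  closed : ∀ {m m′} → m ∈ X → m′ ∣ₘ m → m′ ∈ X
  closed = proj₂ (proj₂ ideal)

  _~_ : Fin r → Fin r → Set
  i ~ j = edge i j ∈ X

  _~?_ : ∀ i j → Dec (i ~ j)
  i ~? j = edge i j ∈ₘ? X

  ~-sym : ∀ {i j} → i ~ j → j ~ i
  ~-sym {i} {j} = subst (_∈ X) (·-comm i j one)

  open Graph _~?_

  layer : ℕ → List (Monomial r)
  layer d = filter (λ m → deg m ≟ d) X

  unique-layer : ∀ d → Unique (layer d)
  unique-layer d = Unique.filter⁺ (λ m → deg m ≟ d) unique-X

  ∈-layer⁻ : ∀ {d m} → m ∈ layer d → m ∈ X × deg m ≡ d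
  ∈-layer⁻ {d} = ∈-filter⁻ (λ m → deg m ≟ d)

  ∈-layer⁺ : ∀ {d m} → m ∈ X → deg m ≡ d → m ∈ layer d
  ∈-layer⁺ {d} = ∈-filter⁺ (λ m → deg m ≟ d)

  one∈X : one ∈ X
  one∈X with nonempty⇒∈ (proj₁ (proj₂ ideal))
  ... | m , m∈X = closed m∈X (one-∣ m)

  -- The monomials counted by `edges` and `cliques`, listed by the same recursions. Those in
  -- `cliqueList` need not belong to `X`; only their edges do.
  edgeList cliqueList : List (Fin r) → List (Monomial r)
  edgeList [] = []
  edgeList (x ∷ S) = map (edge x) (nbrs x (x ∷ S)) ++ edgeList S
  cliqueList [] = []
  cliqueList (x ∷ S) = map (x ·_) (edgeList (nbrs x (x ∷ S))) ++ cliqueList S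

  length-edgeList : ∀ S → length (edgeList S) ≡ edges S
  length-edgeList [] = refl
  length-edgeList (x ∷ S) = trans (length-++ (map (edge x) (nbrs x (x ∷ S))))
    (cong₂ _+_ (length-map (edge x) (nbrs x (x ∷ S))) (length-edgeList S))

  length-cliqueList : ∀ S → length (cliqueList S) ≡ cliques S
  length-cliqueList [] = refl
  length-cliqueList (x ∷ S) = trans (length-++ (map (x ·_) (edgeList (nbrs x (x ∷ S)))))
    (cong₂ _+_ (trans (length-map (x ·_) (edgeList (nbrs x (x ∷ S)))) (length-edgeList (nbrs x (x ∷ S))))
               (length-cliqueList S))

  ∈-edgeList⁻ : ∀ {S m} → m ∈ edgeList S → ∃₂ λ u v → u ∈ S × v ∈ S × u ~ v × m ≡ edge u v
  ∈-edgeList⁻ {x ∷ S} m∈ with ∈-++⁻ (map (edge x) (nbrs x (x ∷ S))) m∈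
  ... | inj₁ p with ∈-map⁻ (edge x) p
  ...   | y , y∈ , refl with ∈-filter⁻ (x ~?_) {xs = x ∷ S} y∈
  ...     | y∈S , x~y = x , y , here refl , y∈S , x~y , refl
  ∈-edgeList⁻ {x ∷ S} m∈ | inj₂ p with ∈-edgeList⁻ {S} p
  ... | u , v , u∈S , v∈S , u~v , eq = u , v , there u∈S , there v∈S , u~v , eq

  ∈-edgeList⁺ : ∀ {S u v} → u ∈ S → v ∈ S → u ~ v → edge u v ∈ edgeList S
  ∈-edgeList⁺ (here refl) v∈S u~v = ∈-++⁺ˡ (∈-map⁺ (edge _) (∈-filter⁺ (_ ~?_) v∈S u~v))
  ∈-edgeList⁺ {x ∷ S} {u} u∈S@(there _) (here refl) u~v =
    subst (_∈ edgeList (x ∷ S)) (·-comm x u one)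
      (∈-++⁺ˡ (∈-map⁺ (edge x) (∈-filter⁺ (x ~?_) u∈S (~-sym u~v))))
  ∈-edgeList⁺ {x ∷ S} (there u∈S) (there v∈S) u~v =
    ∈-++⁺ʳ (map (edge x) (nbrs x (x ∷ S))) (∈-edgeList⁺ u∈S v∈S u~v)

  -- Edges listed at `x` are divisible by `x`, whereas those of the tail only involve vertices of
  -- `S`.
  unique-edgeList : ∀ {S} → Unique S → Unique (edgeList S)
  unique-edgeList [] = []
  unique-edgeList {x ∷ S} uxS@(_ ∷ uS) = Unique.++⁺
    (Unique.map⁺ (λ eq → ·-injectiveˡ one (·-injectiveʳ x eq)) (Unique.filter⁺ (x ~?_) uxS))
    (unique-edgeList uS)
    disjoint
    where
    disjoint : ∀ {m} → ¬ (m ∈ map (edge x) (nbrs x (x ∷ S)) × m ∈ edgeList S)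
    disjoint (p , q) with ∈-map⁻ (edge x) p | ∈-edgeList⁻ {S} q
    ... | y , _ , refl | u , v , u∈S , v∈S , _ , eq with edge-endpoint {x = x} {y} eq
    ...   | inj₁ refl = Unique.Unique[x∷xs]⇒x∉xs uxS u∈S
    ...   | inj₂ refl = Unique.Unique[x∷xs]⇒x∉xs uxS v∈S

  -- The clique is listed at whichever of its vertices comes first; commutativity and symmetry bring
  -- that one to the front.
  ∈-cliqueList : ∀ {S i j k} → i ∈ S → j ∈ S → k ∈ S → i ~ j → i ~ k → j ~ k →
    i · j · k · one ∈ cliqueList S
  ∈-cliqueList {x ∷ S} (here refl) j∈ k∈ i~j i~k j~k =
    ∈-++⁺ˡ (∈-map⁺ (x ·_) (∈-edgeList⁺ (∈-filter⁺ (x ~?_) j∈ i~j) (∈-filter⁺ (x ~?_) k∈ i~k) j~k))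
  ∈-cliqueList {x ∷ S} {i} {j} {k} i∈@(there _) (here refl) k∈ i~j i~k j~k =
    subst (_∈ cliqueList (x ∷ S)) (·-comm x i (k · one))
      (∈-cliqueList (here refl) i∈ k∈ (~-sym i~j) j~k i~k)
  ∈-cliqueList {x ∷ S} {i} {j} {k} i∈@(there _) j∈@(there _) (here refl) i~j i~k j~k =
    subst (_∈ cliqueList (x ∷ S))
      (trans (·-comm x i (j · one)) (cong (i ·_) (·-comm x j one)))
      (∈-cliqueList (here refl) i∈ j∈ (~-sym i~k) (~-sym j~k) i~j)
  ∈-cliqueList {x ∷ S} (there i∈) (there j∈) (there k∈) i~j i~k j~k =
    ∈-++⁺ʳ (map (x ·_) (edgeList (nbrs x (x ∷ S)))) (∈-cliqueList i∈ j∈ k∈ i~j i~k j~k)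

  ∈-layer-1 : ∀ {m} → m ∈ layer 1 → ∃ λ i → m ≡ i · one
  ∈-layer-1 {m} m∈ with deg≡suc⇒· m (proj₂ (∈-layer⁻ m∈))
  ... | i , m′ , refl , eq = i , cong (i ·_) (deg≡0⇒one m′ eq)

  ∈-layer-2 : ∀ {m} → m ∈ layer 2 → ∃₂ λ i j → m ≡ edge i j
  ∈-layer-2 {m} m∈ with deg≡suc⇒· m (proj₂ (∈-layer⁻ m∈))
  ... | i , m′ , refl , eq with deg≡suc⇒· m′ eq
  ...   | j , m″ , refl , eq′ = i , j , cong (λ m → i · j · m) (deg≡0⇒one m″ eq′)

  ∈-layer-3 : ∀ {m} → m ∈ layer 3 → ∃₂ λ i j → ∃ λ k → m ≡ i · j · k · one
  ∈-layer-3 {m} m∈ with deg≡suc⇒· m (proj₂ (∈-layer⁻ m∈))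
  ... | i , m′ , refl , eq with deg≡suc⇒· m′ eq
  ...   | j , m″ , refl , eq′ with deg≡suc⇒· m″ eq′
  ...     | k , m‴ , refl , eq″ = i , j , k , cong (λ m → i · j · k · m) (deg≡0⇒one m‴ eq″)

  left-vertex : ∀ {i m} → i · m ∈ X → i · one ∈ X
  left-vertex {i} {m} p = closed p (·-mono-∣ i (one-∣ m))

  tail-∈ : ∀ {i m} → i · m ∈ X → m ∈ X
  tail-∈ {i} p = closed p (∣-· i ∣-refl)

  -- Bounds on the layer counts

  count-0 : countDeg 0 X ≡ 1
  count-0 = ≤-antisym
    (unique⇒length≤ {ys = one ∷ []} (unique-layer 0) λ m∈ → here (deg≡0⇒one _ (proj₂ (∈-layer⁻ m∈))))
    (∈-length (∈-layer⁺ one∈X (deg-one r)))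

  -- Closure under divisors puts both variables of a degree-2 monomial into `V`, so the edge bound
  -- for graphs with loops applies.
  count-2≤triangular : countDeg 2 X ≤ triangular (countDeg 1 X)
  count-2≤triangular = begin
    countDeg 2 X               ≤⟨ unique⇒length≤ (unique-layer 2) layer-2⊆ ⟩
    length (edgeList V)        ≡⟨ length-edgeList V ⟩
    edges V                    ≤⟨ edges≤triangular V ⟩
    triangular (length V)      ≡⟨ cong triangular (length-map (_· one) V) ⟨
    triangular (length (map (_· one) V))
      ≤⟨ triangular-mono-≤ (unique⇒length≤ unique-V ⊆layer-1) ⟩
    triangular (countDeg 1 X)  ∎
    where
    open ≤-Reasoning
    vertex? : ∀ i → Dec (i · one ∈ X)
    vertex? i = (i · one) ∈ₘ? X
    V = filter vertex? (allFin r)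
    unique-V : Unique (map (_· one) V)
    unique-V = Unique.map⁺ (·-injectiveˡ one) (Unique.filter⁺ vertex? (Unique.allFin⁺ r))
    ⊆layer-1 : ∀ {m} → m ∈ map (_· one) V → m ∈ layer 1
    ⊆layer-1 m∈ with ∈-map⁻ (_· one) m∈
    ... | i , i∈V , refl = ∈-layer⁺ (proj₂ (∈-filter⁻ vertex? {xs = allFin r} i∈V)) (deg-vertex i)
    layer-2⊆ : ∀ {m} → m ∈ layer 2 → m ∈ edgeList V
    layer-2⊆ m∈ with ∈-layer-2 m∈ | proj₁ (∈-layer⁻ m∈)
    ... | i , j , refl | i~j = ∈-edgeList⁺
      (∈-filter⁺ vertex? (∈-allFin i) (left-vertex i~j))
      (∈-filter⁺ vertex? (∈-allFin j) (tail-∈ i~j)) i~j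

  Covers : List (Fin r) → Set
  Covers S = ∀ i → i · one ∈ X → i ∈ S

  count-1≤length : ∀ {S} → Covers S → countDeg 1 X ≤ length S
  count-1≤length {S} cov = subst (countDeg 1 X ≤_) (length-map (_· one) S)
    (unique⇒length≤ (unique-layer 1) ⊆S)
    where
    ⊆S : ∀ {m} → m ∈ layer 1 → m ∈ map (_· one) S
    ⊆S m∈ with ∈-layer-1 m∈ | proj₁ (∈-layer⁻ m∈)
    ... | i , refl | m∈X = ∈-map⁺ (_· one) (cov i m∈X)

  edges≤count-2 : ∀ {S} → Unique S → edges S ≤ countDeg 2 X
  edges≤count-2 {S} uS = subst (_≤ countDeg 2 X) (length-edgeList S)
    (unique⇒length≤ (unique-edgeList uS) ⊆layer-2)
    where
    ⊆layer-2 : ∀ {m} → m ∈ edgeList S → m ∈ layer 2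
    ⊆layer-2 m∈ with ∈-edgeList⁻ {S} m∈
    ... | u , v , _ , _ , u~v , refl = ∈-layer⁺ u~v (deg-edge u v)

  count-3≤cliques : ∀ {S} → Covers S → countDeg 3 X ≤ cliques S
  count-3≤cliques {S} cov = subst (countDeg 3 X ≤_) (length-cliqueList S)
    (unique⇒length≤ (unique-layer 3) ⊆cliqueList)
    where
    ⊆cliqueList : ∀ {m} → m ∈ layer 3 → m ∈ cliqueList S
    ⊆cliqueList m∈ with ∈-layer-3 m∈ | proj₁ (∈-layer⁻ m∈)
    ... | i , j , k , refl | m∈X = ∈-cliqueList
      (cov i (left-vertex m∈X)) (cov j (left-vertex (tail-∈ m∈X))) (cov k (tail-∈ (tail-∈ m∈X)))
      (closed m∈X (·-mono-∣ i (·-mono-∣ j (one-∣ _))))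
      (closed m∈X (·-mono-∣ i (∣-· j ∣-refl)))
      (tail-∈ m∈X)

  -- By purity `m` is not maximal, so the finite search finds a proper multiple in `X`; closure then
  -- gives a multiple by a single variable.
  pure⇒extend : ∀ {e m} → IsPure e X → m ∈ X → deg m ≢ e → ∃ λ i → i · m ∈ X
  pure⇒extend {e} {m} pure m∈X deg≢e
    with any? (λ m′ → Pointwise.decidable _≤?_ m m′ ×-dec ¬? (m′ ≟ₘ m)) X
  ... | yes p with find p
  ...   | m′ , m′∈X , m∣m′ , m′≢m with ∣∧≢⇒· m∣m′ m′≢m
  ...     | i , q = i , closed m′∈X q
  pure⇒extend {e} {m} pure m∈X deg≢e | no ¬p = contradiction
    (pure (m∈X , λ m′∈X m∣m′ → decidable-stable (_ ≟ₘ m) λ m′≢m → ¬p (lose m′∈X (m∣m′ , m′≢m))))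
    deg≢e

  -- Extending twice yields a cubic monomial of `X` divisible by the variable `i`; its quadratic
  -- divisors are the three edges.
  pure⇒clique : ∀ {i} → IsPure 3 X → i · one ∈ X → ∃₂ λ j k → i ~ j × i ~ k × j ~ k
  pure⇒clique {i} pure i∈X
    with pure⇒extend pure i∈X (λ eq → contradiction (trans (sym (deg-vertex i)) eq) λ ())
  ... | j , j~i
    with pure⇒extend pure j~i (λ eq → contradiction (trans (sym (deg-edge j i)) eq) λ ())
  ...   | k , kji∈X = j , k , ~-sym j~i ,
    ~-sym (closed kji∈X (·-mono-∣ k (∣-· j ∣-refl))) ,
    ~-sym (closed kji∈X (·-mono-∣ k (·-mono-∣ j (one-∣ _))))

  unique-length≤r : ∀ {S : List (Fin r)} → Unique S → length S ≤ r
  unique-length≤r {S} uS = subst (length S ≤_) (length-tabulate id) (unique⇒length≤ uS (λ {i} _ → ∈-allFin i))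

  Larger : List (Fin r) → Set
  Larger S = ∃ λ S′ → Grown S′ × Unique S′ × length S < length S′

  add-vertex : ∀ {S x} → Grown S → Unique S → x ∉ S → Any (x ~_) (x ∷ S) → Larger S
  add-vertex G uS x∉S x~ = _ , vertex x~ G , unique-∷ x∉S uS , ≤-refl

  -- Take a clique through `i` and try its vertices in turn. The later ones lie outside `S`, since
  -- `i` has no neighbour there once the first attempt fails. If all three fail, they are loopless,
  -- hence distinct, and have no neighbour in `S`: a new triangle.
  enlarge : ∀ {S i} → IsPure 3 X → Grown S → Unique S → i ∉ S → i · one ∈ X → Larger S
  enlarge {S} {i} pure G uS i∉S i∈X with pure⇒clique pure i∈X
  ... | j , k , i~j , i~k , j~k with any? (i ~?_) (i ∷ S)
  ...   | yes i~ = add-vertex G uS i∉S i~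
  ...   | no i≁ with any? (j ~?_) (j ∷ S)
  ...     | yes j~ = add-vertex G uS (λ j∈S → i≁ (there (lose j∈S i~j))) j~
  ...     | no j≁ with any? (k ~?_) (k ∷ S)
  ...       | yes k~ = add-vertex G uS (λ k∈S → i≁ (there (lose k∈S i~k))) k~
  ...       | no k≁ =
    i ∷ j ∷ k ∷ S ,
    triangle i~j i~k j~k (¬Any⇒All¬ _ i≁) (¬Any⇒All¬ _ j≁) (¬Any⇒All¬ _ k≁) G ,
    unique-∷ i∉jkS (unique-∷ j∉kS (unique-∷ (λ k∈S → i≁ (there (lose k∈S i~k))) uS)) ,
    m≤n+m _ 2
    where
    j∉kS : j ∉ k ∷ S
    j∉kS (here refl)  = j≁ (here j~k)
    j∉kS (there j∈S) = i≁ (there (lose j∈S i~j))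
    i∉jkS : i ∉ j ∷ k ∷ S
    i∉jkS (here refl)          = i≁ (here i~j)
    i∉jkS (there (here refl))  = i≁ (here i~k)
    i∉jkS (there (there i∈S)) = i∉S i∈S

  -- The number `n` bounds the remaining enlargements. When it is 0, a missing vertex would give a
  -- duplicate-free list longer than `r`.
  grown-cover : ∀ {S} → IsPure 3 X → ∀ n → r ≤ n + length S → Grown S → Unique S →
    ∃ λ S′ → Grown S′ × Unique S′ × Covers S′
  grown-cover {S} pure n r≤ G uS with Fin.any? (λ i → ¬? (i ∈? S) ×-dec ((i · one) ∈ₘ? X))
  ... | no ¬p = S , G , uS , λ i i∈X → decidable-stable (i ∈? S) (λ i∉S → ¬p (i , i∉S , i∈X))
  grown-cover pure zero r≤ G uS | yes (i , i∉S , _) =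
    contradiction (≤-trans (unique-length≤r (unique-∷ i∉S uS)) r≤) 1+n≰n
  grown-cover {S} pure (suc n) r≤ G uS | yes (i , i∉S , i∈X) with enlarge pure G uS i∉S i∈X
  ... | S′ , G′ , uS′ , S<S′ = grown-cover pure n
    (≤-trans r≤ (≤-trans (≤-reflexive (sym (+-suc n (length S)))) (+-monoʳ-≤ n S<S′))) G′ uS′

  -- One-sided comparisons suffice, as the right side of `cliques-bound` increases with the edges
  -- and decreases with the vertices.
  pure⇒count-3≤ : IsPure 3 X → countDeg 3 X ≤ countDeg 2 X + macaulayBound 2 (countDeg 2 X ∸ countDeg 1 X)
  pure⇒count-3≤ pure with grown-cover pure r (m≤m+n r 0) [] []
  ... | S , G , uS , cov = begin
    countDeg 3 X                                           ≤⟨ count-3≤cliques cov ⟩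
    cliques S                                              ≤⟨ cliques-bound G ⟩
    edges S + macaulayBound 2 (edges S ∸ length S)         ≤⟨ +-mono-≤ (edges≤count-2 uS)
      (macaulayBound-2-mono-≤ (∸-mono (edges≤count-2 uS) (count-1≤length cov))) ⟩
    countDeg 2 X + macaulayBound 2 (countDeg 2 X ∸ countDeg 1 X) ∎
    where open ≤-Reasoning

-- Differentiability in socle degree at most 3

theorem3p3 : (e : ℕ) → e ≤ 3 → (h : Vec ℕ (suc e)) →
    IsPureOSequence h → NonDecreasing h → Differentiable h
theorem3p3 e e≤3 h (r , X , ideal , pure , count) mono = mono , h₀≡1 , growth e≤3 h pure count
  where
  open OrderIdeal X ideal

  h₀≡1 : lookup (Δ h) fzero ≡ 1
  h₀≡1 = trans (count fzero) count-0

  Δ₂ : countDeg 2 X ∸ countDeg 1 X ≤ macaulayBound 1 (countDeg 1 X ∸ countDeg 0 X)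
  Δ₂ = begin
    countDeg 2 X ∸ countDeg 1 X                 ≤⟨ ∸-monoˡ-≤ (countDeg 1 X) count-2≤triangular ⟩
    triangular (countDeg 1 X) ∸ countDeg 1 X    ≡⟨ triangular-pred (countDeg 1 X) ⟩
    triangular (countDeg 1 X ∸ 1)               ≡⟨ cong (λ c → triangular (countDeg 1 X ∸ c)) count-0 ⟨
    triangular (countDeg 1 X ∸ countDeg 0 X)    ≡⟨ macaulayBound-1 (countDeg 1 X ∸ countDeg 0 X) ⟨
    macaulayBound 1 (countDeg 1 X ∸ countDeg 0 X) ∎
    where open ≤-Reasoning

  -- `e` and `h` are quantified afresh so that matching on `h` can fix the socle degree; for `d = 2`
  -- this turns purity into `IsPure 3 X`. Matching on `count` replaces the entries by layer counts.
  growth : ∀ {e} → e ≤ 3 → (h : Vec ℕ (suc e)) → IsPure e X →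
    (∀ i → lookup h i ≡ countDeg (toℕ i) X) → (d : Fin e) → 1 ≤ toℕ d →
    lookup (Δ h) (fsuc d) ≤ macaulayBound (toℕ d) (lookup (Δ h) (inject₁ d))
  growth _ (_ ∷ _ ∷ _ ∷ _) pure count (fsuc fzero) _
    with refl ← count fzero | refl ← count (fsuc fzero) | refl ← count (fsuc (fsuc fzero)) = Δ₂
  growth _ (_ ∷ _ ∷ _ ∷ _ ∷ []) pure count (fsuc (fsuc fzero)) _
    with refl ← count (fsuc fzero) | refl ← count (fsuc (fsuc fzero))
       | refl ← count (fsuc (fsuc (fsuc fzero))) =
    m≤n+o⇒m∸n≤o (countDeg 3 X) (countDeg 2 X) (pure⇒count-3≤ pure)
  growth (s≤s (s≤s (s≤s ()))) (_ ∷ _ ∷ _ ∷ _ ∷ _ ∷ _) pure count (fsuc (fsuc _)) _
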